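{- For a word $u$ of length $n$, the longest left-seed array $\mathsf{LSeed}^M[1..n]$, where $\mathsf{LSeed}^M[i]=\mathrm{lseedmax}(u[1..i])$, can be computed in $O(n)$ time.
   Context: Words are over a finite alphabet; $u[1..i]$ is the prefix of length $i$. A word $s$ covers $w$ if every position of $w$ lies in some occurrence of $s$ in $w$. A seed of $x$ is a factor $s$ of $x$ such that $x$ is a factor of some word covered by $s$; a left seed is a seed that is a prefix of $x$. $\mathrm{lseedmax}(x)$ is the length of the longest left seed of $x$ shorter than $x$, or $0$ if there is none. -}

module Defs where

open import Data.Fin using (Fin; toℕ)
open import Data.List using (List; []; _∷_; length; map; take; drop; head)
open import Data.List.Relation.Binary.Infix.Heterogeneous using (Infix)
open import Data.List.Relation.Binary.Prefix.Heterogeneous using (Prefix)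
open import Data.Maybe using (Maybe; just; nothing)
open import Data.Nat using (ℕ; zero; suc; _+_; _*_; _∸_; _^_; _%_; _≤_; _<_; _<?_; _≟_)
open import Data.Nat.Properties using (m^n≢0)
open import Data.Product using (Σ-syntax; ∃-syntax; _×_)
open import Data.Sum using (_⊎_)
open import Relation.Binary.PropositionalEquality using (_≡_)
open import Relation.Nullary using (¬_; Dec; yes; no)

Word : ℕ → Set
Word k = List (Fin k)

private
  variable
    k : ℕ

Factor : Word k → Word k → Set
Factor = Infix _≡_

IsPrefix : Word k → Word k → Set
IsPrefix = Prefix _≡_

-- Positions of w are 0, …, length w - 1; s occurs in w at j when it is a
-- prefix of drop j w, and this occurrence occupies positions j, …, j + length s - 1.
Covers : Word k → Word k → Set
Covers s w = ∀ p → p < length w →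
  ∃[ j ] (IsPrefix s (drop j w) × j ≤ p × p < j + length s)

Seed : Word k → Word k → Set
Seed {k} s x = Factor s x × (Σ[ w ∈ Word k ] (Covers s w × Factor x w))

LeftSeed : Word k → Word k → Set
LeftSeed s x = Seed s x × IsPrefix s x

ShorterLeftSeed : Word k → Word k → Set
ShorterLeftSeed s x = LeftSeed s x × length s < length x

-- The graph of lseedmax: LSeedMax x m says lseedmax(x) = m.
LSeedMax : Word k → ℕ → Set
LSeedMax {k} x m =
    (Σ[ s ∈ Word k ] (ShorterLeftSeed s x × length s ≡ m
                      × (∀ s′ → ShorterLeftSeed s′ x → length s′ ≤ m)))
  ⊎ ((¬ (Σ[ s ∈ Word k ] ShorterLeftSeed s x)) × m ≡ 0)

LSeedArray : Word k → (ℕ → ℕ) → Set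
LSeedArray u a = ∀ i → 1 ≤ i → i ≤ length u → LSeedMax (take i u) (a i)

-- The word RAM: registers and memory cells hold numbers below 2 ^ w, where w is
-- the word size; every instruction takes unit time; there is no multiplication.

data Instr : Set where
  const : (r : ℕ) (c : ℕ) → Instr    -- r := c
  add   : (r s t : ℕ) → Instr        -- r := s + t  (modulo 2 ^ w)
  sub   : (r s t : ℕ) → Instr        -- r := s ∸ t  (truncated)
  load  : (r s : ℕ) → Instr          -- r := mem[s]
  store : (r s : ℕ) → Instr          -- mem[r] := s
  jump  : (l : ℕ) → Instr
  jlt   : (r s l : ℕ) → Instr        -- if r < s jump to l
  jeq   : (r s l : ℕ) → Instr        -- if r = s jump to l

Program : Set
Program = List Instr

fetch : Program → ℕ → Maybe Instr
fetch P pc = head (drop pc P)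

record State : Set where
  constructor state
  field
    pc  : ℕ
    reg : ℕ → ℕ
    mem : ℕ → ℕ

open State public

update : (ℕ → ℕ) → ℕ → ℕ → ℕ → ℕ
update f i v j with i ≟ j
... | yes _ = v
... | no  _ = f j

branch : {A : Set} → Dec A → ℕ → ℕ → ℕ
branch (yes _) l l′ = l
branch (no  _) l l′ = l′

wrap : ℕ → ℕ → ℕ
wrap w x = _%_ x (2 ^ w) {{m^n≢0 2 w}}

exec : ℕ → Instr → State → State
exec w (const r c) (state p ρ μ) = state (suc p) (update ρ r (wrap w c)) μ
exec w (add r s t) (state p ρ μ) = state (suc p) (update ρ r (wrap w (ρ s + ρ t))) μ
exec w (sub r s t) (state p ρ μ) = state (suc p) (update ρ r (ρ s ∸ ρ t)) μ
exec w (load r s)  (state p ρ μ) = state (suc p) (update ρ r (μ (ρ s))) μ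
exec w (store r s) (state p ρ μ) = state (suc p) ρ (update μ (ρ r) (ρ s))
exec w (jump l)    (state p ρ μ) = state l ρ μ
exec w (jlt r s l) (state p ρ μ) = state (branch (ρ r <? ρ s) l (suc p)) ρ μ
exec w (jeq r s l) (state p ρ μ) = state (branch (ρ r ≟ ρ s) l (suc p)) ρ μ

-- Run w P σ t σ′: with word size w, started in σ, the program P halts in state
-- σ′ after exactly t steps.  It halts when pc leaves the program.
data Run (w : ℕ) (P : Program) : State → ℕ → State → Set where
  halt : ∀ {σ} → fetch P (pc σ) ≡ nothing → Run w P σ 0 σ
  step : ∀ {σ σ′ t I} → fetch P (pc σ) ≡ just I →
         Run w P (exec w I σ) t σ′ → Run w P σ (suc t) σ′

contents : List ℕ → ℕ → ℕ
contents []       _       = 0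
contents (x ∷ xs) zero    = x
contents (x ∷ xs) (suc i) = contents xs i

-- The length of u is in cell 0 and its i-th letter (1 ≤ i ≤ length u) in cell i;
-- everything else is 0.
initial : Word k → State
initial u = state 0 (λ _ → 0) (contents (length u ∷ map toℕ u))

-- One program, for words of all lengths over the alphabet of size k, leaves in
-- memory an array that is correct for the input within c * (n + 1) steps.
-- As usual for the word RAM, words are assumed to have log₂ n + O(1) bits, and
-- to be able to hold a letter.
ComputableInLinearTime : (k : ℕ) → (Word k → (ℕ → ℕ) → Set) → Set
ComputableInLinearTime k Correct =
  Σ[ P ∈ Program ] Σ[ c ∈ ℕ ] (∀ (u : Word k) (w : ℕ) →
    k ≤ 2 ^ w → c * suc (length u) ≤ 2 ^ w →
    ∃[ t ] ∃[ σ ] (Run w P (initial u) t σ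
                   × t ≤ c * suc (length u)
                   × Correct u (mem σ)))

{-# OPTIONS --safe #-}

-- A left seed s of x shorter than x yields a nonempty proper border of x: the
-- occurrence of s that covers the last position of x starts strictly inside x.
-- Conversely, if x has a nonempty proper border, then x without its last letter
-- is a left seed of x.  So lseedmax (x) is length x ∸ 1 or 0 according to whether
-- x is bordered, and the border array of Knuth, Morris and Pratt decides this for
-- all prefixes in linear time.
module Submission where

open import Defs
open import Data.Fin using (toℕ)
open import Data.Fin.Properties using (toℕ-injective)
open import Data.List using ([]; _∷_; _++_; length; map; take; drop)
open import Data.List.Properties using (length-++; length-take; length-drop; take++drop≡id)
import Data.List.Relation.Binary.Infix.Heterogeneous as Infix
import Data.List.Relation.Binary.Pointwise as Pointwise
import Data.List.Relation.Binary.Prefix.Heterogeneous as Prefix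
import Data.List.Relation.Binary.Prefix.Heterogeneous.Properties as Prefixₚ
open import Data.Maybe using (just; nothing)
open import Data.Nat using (ℕ; zero; suc; _+_; _*_; _∸_; _^_; _≤_; _<_; z≤n; s≤s; s≤s⁻¹; _<?_; _≟_)
open import Data.Nat.DivMod using (m<n⇒m%n≡m)
open import Data.Nat.Properties
open import Data.Nat.Tactic.RingSolver using (solve-∀)
open import Data.Product using (Σ-syntax; ∃-syntax; _×_; _,_; proj₁; proj₂)
open import Data.Sum using (inj₁; inj₂)
open import Relation.Binary.PropositionalEquality
  using (_≡_; _≢_; refl; sym; trans; cong; cong₂; subst; module ≡-Reasoning)
open import Relation.Nullary using (¬_; yes; no; contradiction)

-- Borders

-- Border g i b: the prefix g 0 … g (i - 1) has a proper border of length b, that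
-- is, it has period q = i - b.
Border : (ℕ → ℕ) → ℕ → ℕ → Set
Border g i b = ∃[ q ] (0 < q × q + b ≡ i × (∀ p → p < b → g p ≡ g (q + p)))

LongestBorder : (ℕ → ℕ) → ℕ → ℕ → Set
LongestBorder g i b = Border g i b × (∀ b′ → Border g i b′ → b′ ≤ b)

module _ {g : ℕ → ℕ} where

  border-empty : ∀ {i} → 0 < i → Border g i 0
  border-empty {i} 0<i = i , 0<i , +-identityʳ i , λ _ ()

  border-< : ∀ {i b} → Border g i b → b < i
  border-< (q , 0<q , refl , _) = +-monoˡ-≤ _ 0<q

  -- The periods add up: a shift by `r` stays inside the border of length `j`, and a further shift
  -- by `q` carries it to the end of the prefix of length `i`.
  border-trans : ∀ {i j b} → Border g i j → Border g j b → Border g i b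
  border-trans {b = b} (q , 0<q , refl , f) (r , _ , refl , h) =
    q + r , ≤-trans 0<q (m≤m+n q r) , +-assoc q r b ,
    λ p p<b → trans (h p p<b)
      (trans (f (r + p) (+-monoʳ-< r p<b)) (cong g (sym (+-assoc q r p))))

  -- Both borders are suffixes of the prefix of length `i`, so the shorter is a suffix of the
  -- longer. The longer one thus has as a period the difference `j ∸ b` of the periods `r` and `q`.
  border-of-border : ∀ {i j b} → Border g i j → Border g i b → b < j → Border g j b
  border-of-border {i} {j} {b} (q , _ , q+j≡i , f) (r , _ , r+b≡i , h) b<j =
    j ∸ b , m<n⇒0<n∸m b<j , d+b≡j , λ p p<b → trans (h p p<b) (trans
      (cong g (trans (cong (_+ p) r≡q+d) (+-assoc q (j ∸ b) p)))
      (sym (f (j ∸ b + p) (<-≤-trans (+-monoʳ-< (j ∸ b) p<b) (≤-reflexive d+b≡j)))))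
    where
    d+b≡j : j ∸ b + b ≡ j
    d+b≡j = m∸n+n≡m (<⇒≤ b<j)

    r≡q+d : r ≡ q + (j ∸ b)
    r≡q+d = +-cancelʳ-≡ b r (q + (j ∸ b)) (begin
      r + b              ≡⟨ trans r+b≡i (sym q+j≡i) ⟩
      q + j              ≡⟨ cong (q +_) (sym d+b≡j) ⟩
      q + (j ∸ b + b)    ≡⟨ sym (+-assoc q (j ∸ b) b) ⟩
      q + (j ∸ b) + b    ∎)
      where open ≡-Reasoning

  border-extend : ∀ {i j} → Border g i j → g j ≡ g i → Border g (suc i) (suc j)
  border-extend {j = j} (q , 0<q , refl , f) eq = q , 0<q , +-suc q j , f′
    where
    f′ : ∀ p → p < suc j → g p ≡ g (q + p)
    f′ p p<1+j with p ≟ j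
    ... | yes refl = eq
    ... | no  p≢j  = f p (≤∧≢⇒< (s≤s⁻¹ p<1+j) p≢j)

  border-restrict : ∀ {i b} → Border g (suc i) (suc b) → Border g i b × g b ≡ g i
  border-restrict {i} {b} (q , 0<q , eq , f) =
    (q , 0<q , q+b≡i , λ p p<b → f p (m≤n⇒m≤1+n p<b)) ,
    trans (f b ≤-refl) (cong g q+b≡i)
    where
    q+b≡i : q + b ≡ i
    q+b≡i = suc-injective (trans (sym (+-suc q b)) eq)

  border-cong : ∀ {h i b} → (∀ p → p < i → g p ≡ h p) → Border g i b → Border h i b
  border-cong {b = b} g≗h (q , 0<q , refl , f) = q , 0<q , refl , λ p p<b →
    trans (sym (g≗h p (≤-trans p<b (m≤n+m b q))))
      (trans (f p p<b) (g≗h (q + p) (+-monoʳ-< q p<b)))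

  -- Candidate i j: j is a border of the prefix of length i, and no longer border
  -- of that prefix can be extended to one of the prefix of length i + 1.
  Candidate : ℕ → ℕ → Set
  Candidate i j = Border g i j × (∀ b → Border g (suc i) (suc b) → b ≤ j)

  candidate-initial : Candidate 1 0
  candidate-initial = border-empty (s≤s z≤n) ,
    λ b B → s≤s⁻¹ (border-< (proj₁ (border-restrict B)))

  longest⇒candidate : ∀ {i j} → LongestBorder g i j → Candidate i j
  longest⇒candidate (B , max) = B , λ b B′ → max b (proj₁ (border-restrict B′))

  longest-initial : LongestBorder g 1 0
  longest-initial = border-empty (s≤s z≤n) , λ b B → s≤s⁻¹ (border-< B)

  match⇒longest : ∀ {i j} → Candidate i j → g j ≡ g i → LongestBorder g (suc i) (suc j)
  match⇒longest (B , max) eq = border-extend B eq , λ where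
    zero    _  → z≤n
    (suc b) B′ → s≤s (max b B′)

  -- A border of positive length would extend one of length at most 0, hence the empty one, and the
  -- mismatch forbids that.
  mismatch⇒longest : ∀ {i} → Candidate i 0 → g 0 ≢ g i → LongestBorder g (suc i) 0
  mismatch⇒longest (_ , max) neq = border-empty (s≤s z≤n) , λ where
    zero    _  → z≤n
    (suc b) B′ → contradiction
      (subst (λ b → g b ≡ _) (n≤0⇒n≡0 (max b B′)) (proj₂ (border-restrict B′))) neq

  -- This is the failure step of Knuth, Morris and Pratt. An extendable border has length at most
  -- `j`, and the mismatch excludes `j` itself. A shorter one is a border of the prefix of length
  -- `j`, so it is at most `j′`.
  mismatch⇒candidate : ∀ {i j j′} → Candidate i j → g j ≢ g i →
                       LongestBorder g j j′ → Candidate i j′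
  mismatch⇒candidate {i} {j} {j′} (B , max) neq (B″ , max″) =
    border-trans B B″ , shorter
    where
    shorter : ∀ b → Border g (suc i) (suc b) → b ≤ j′
    shorter b B′ with border-restrict B′ | b ≟ j
    ... | Bᵢ , eq | yes refl = contradiction eq neq
    ... | Bᵢ , eq | no  b≢j  = max″ b (border-of-border B Bᵢ (≤∧≢⇒< (max b B′) b≢j))

-- Left seeds

letter : ∀ {k} → Word k → ℕ → ℕ
letter u = contents (map toℕ u)

letter-prefix : ∀ {k} {s t : Word k} → IsPrefix s t →
                ∀ p → p < length s → letter s p ≡ letter t p
letter-prefix (refl Prefix.∷ _)  zero    _         = refl
letter-prefix (refl Prefix.∷ pf) (suc p) (s≤s p<s) = letter-prefix pf p p<s

letters⇒prefix : ∀ {k} (s t : Word k) → length s ≤ length t →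
                 (∀ p → p < length s → letter s p ≡ letter t p) → IsPrefix s t
letters⇒prefix []      t       _         _  = Prefix.[]
letters⇒prefix (a ∷ s) (b ∷ t) (s≤s s≤t) eq =
  toℕ-injective (eq 0 (s≤s z≤n)) Prefix.∷
  letters⇒prefix s t s≤t (λ p p<s → eq (suc p) (s≤s p<s))

letter-drop : ∀ {k} q (u : Word k) p → letter (drop q u) p ≡ letter u (q + p)
letter-drop zero    u       p = refl
letter-drop (suc q) []      p = refl
letter-drop (suc q) (_ ∷ u) p = letter-drop q u p

take-prefix : ∀ {k} i (u : Word k) → IsPrefix (take i u) u
take-prefix zero    u       = Prefix.[]
take-prefix (suc i) []      = Prefix.[]
take-prefix (suc i) (_ ∷ u) = refl Prefix.∷ take-prefix i u

length-take-≤ : ∀ {k} {i} {u : Word k} → i ≤ length u → length (take i u) ≡ i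
length-take-≤ {i = i} {u} i≤u = trans (length-take i u) (m≤n⇒m⊓n≡m i≤u)

drop-length-++ : ∀ {k} (v s : Word k) → drop (length v) (v ++ s) ≡ s
drop-length-++ []      s = refl
drop-length-++ (_ ∷ v) s = drop-length-++ v s

factor-offset : ∀ {k} {x w : Word k} → Factor x w →
                ∃[ d ] (d + length x ≤ length w × IsPrefix x (drop d w))
factor-offset (Infix.here pf) = 0 , Prefixₚ.length-mono pf , pf
factor-offset (Infix.there f) with factor-offset f
... | d , le , pf = suc d , s≤s le , pf

seed⇒border : ∀ {k} {s x : Word k} → ShorterLeftSeed s x →
              ∃[ b ] Border (letter x) (length x) (suc b)
seed⇒border {s = s} {x} (((_ , w , cov , x∈w) , s⊑x) , s<x)
  with d , fits , x⊑w ← factor-offset x∈w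
  with length x in ∣x∣
... | suc n
  -- The last letter of `x` lies at position `d + n` of `w`; the occurrence of `s` covering it
  -- starts at `j`.
  with j , s⊑w , j≤p , p<j+s ← cov (d + n) (≤-trans (≤-reflexive (sym (+-suc d n))) fits)
  = n ∸ q , q , 0<q , q+b , matches
  where
  -- `s` has length at most `n`, so an occurrence starting at or before `d` would end before
  -- position `d + n`.
  d<j : d < j
  d<j = +-cancelʳ-< n d j (<-≤-trans p<j+s (+-monoʳ-≤ j (s≤s⁻¹ s<x)))

  q : ℕ
  q = j ∸ d

  d+q≡j : d + q ≡ j
  d+q≡j = m+[n∸m]≡n (<⇒≤ d<j)

  0<q : 0 < q
  0<q = m<n⇒0<n∸m d<j

  q≤n : q ≤ n
  q≤n = +-cancelˡ-≤ d q n (≤-trans (≤-reflexive d+q≡j) j≤p)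

  q+b : q + suc (n ∸ q) ≡ suc n
  q+b = trans (+-suc q (n ∸ q)) (cong suc (m+[n∸m]≡n q≤n))

  -- The occurrence of `s` reaches the last letter of `x`, so it contains the whole suffix of `x`
  -- from offset `q`. That suffix is therefore a prefix of `s`, and so of `x`.
  b≤s : suc (n ∸ q) ≤ length s
  b≤s = +-cancelˡ-≤ j (suc (n ∸ q)) (length s) (begin
    j + suc (n ∸ q)        ≡⟨ cong (_+ suc (n ∸ q)) (sym d+q≡j) ⟩
    d + q + suc (n ∸ q)    ≡⟨ +-assoc d q (suc (n ∸ q)) ⟩
    d + (q + suc (n ∸ q))  ≡⟨ cong (d +_) q+b ⟩
    d + suc n              ≡⟨ +-suc d n ⟩
    suc (d + n)            ≤⟨ p<j+s ⟩
    j + length s           ∎)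
    where open ≤-Reasoning

  matches : ∀ p → p < suc (n ∸ q) → letter x p ≡ letter x (q + p)
  matches p p<b = begin
    letter x p               ≡⟨ sym (letter-prefix s⊑x p p<s) ⟩
    letter s p               ≡⟨ letter-prefix s⊑w p p<s ⟩
    letter (drop j w) p      ≡⟨ letter-drop j w p ⟩
    letter w (j + p)         ≡⟨ cong (λ j → letter w (j + p)) (sym d+q≡j) ⟩
    letter w (d + q + p)     ≡⟨ cong (letter w) (+-assoc d q p) ⟩
    letter w (d + (q + p))   ≡⟨ sym (letter-drop d w (q + p)) ⟩
    letter (drop d w) (q + p) ≡⟨ sym (letter-prefix x⊑w (q + p) q+p<x) ⟩
    letter x (q + p)         ∎
    where
    open ≡-Reasoning
    p<s : p < length s
    p<s = ≤-trans p<b b≤s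
    q+p<x : q + p < length x
    q+p<x = <-≤-trans (+-monoʳ-< q p<b) (≤-reflexive (trans q+b (sym ∣x∣)))

-- If x has period q, then its prefix s of length n = length x - 1 covers
-- take q x ++ s, which extends x.
border⇒seed : ∀ {k} {x : Word k} {n b} → length x ≡ suc n →
              Border (letter x) (suc n) (suc b) → ShorterLeftSeed (take n x) x
border⇒seed {x = x} {n} {b} ∣x∣ (q , 0<q , q+b , matches) =
  ((Infix.here s⊑x , w , covers , Infix.here x⊑w) , s⊑x) ,
  ≤-reflexive (trans (cong suc ∣s∣) (sym ∣x∣))
  where
  s = take n x
  w = take q x ++ s

  s⊑x : IsPrefix s x
  s⊑x = take-prefix n x

  ∣s∣ : length s ≡ n
  ∣s∣ = length-take-≤ (≤-trans (n≤1+n n) (≤-reflexive (sym ∣x∣)))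

  q≤n : q ≤ n
  q≤n = s≤s⁻¹ (≤-trans (s≤s (m≤m+n q b)) (≤-reflexive (trans (sym (+-suc q b)) q+b)))

  b≤n : suc b ≤ n
  b≤n = s≤s⁻¹ (≤-trans (+-monoˡ-≤ (suc b) 0<q) (≤-reflexive q+b))

  ∣v∣ : length (take q x) ≡ q
  ∣v∣ = length-take-≤ (≤-trans q≤n (≤-trans (n≤1+n n) (≤-reflexive (sym ∣x∣))))

  ∣w∣ : length w ≡ q + n
  ∣w∣ = trans (length-++ (take q x)) (cong₂ _+_ ∣v∣ ∣s∣)

  ∣suffix∣ : length (drop q x) ≡ suc b
  ∣suffix∣ = trans (length-drop q x)
    (trans (cong (_∸ q) (trans ∣x∣ (sym q+b))) (m+n∸m≡n q (suc b)))

  -- This suffix is the border, and having length at most `n` it is already a prefix of `s`.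
  -- Prepending `take q x` turns this into `x` being a prefix of `w`.
  suffix⊑s : IsPrefix (drop q x) s
  suffix⊑s = letters⇒prefix (drop q x) s
    (≤-trans (≤-reflexive ∣suffix∣) (≤-trans b≤n (≤-reflexive (sym ∣s∣))))
    (λ p p<suffix → let p<b = <-≤-trans p<suffix (≤-reflexive ∣suffix∣) in
      trans (letter-drop q x p) (trans (sym (matches p p<b))
        (sym (letter-prefix s⊑x p (<-≤-trans p<b (≤-trans b≤n (≤-reflexive (sym ∣s∣))))))))

  x⊑w : IsPrefix x w
  x⊑w = subst (λ v → IsPrefix v w) (take++drop≡id q x)
    (Prefixₚ.++⁺ (Pointwise.refl refl) suffix⊑s)

  covers : Covers s w
  -- The occurrence at 0 covers the positions below `n`. The one at `q` ends with `w`, and `q ≤ n`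
  -- leaves no gap between them.
  covers p p<w with p <? n
  ... | yes p<n = 0 , Prefixₚ.trans trans s⊑x x⊑w , z≤n , <-≤-trans p<n (≤-reflexive (sym ∣s∣))
  ... | no  p≮n = q , subst (IsPrefix s) (sym drop≡s) (Prefixₚ.fromPointwise (Pointwise.refl refl)) ,
    ≤-trans q≤n (≮⇒≥ p≮n) ,
    <-≤-trans p<w (≤-reflexive (trans ∣w∣ (cong (q +_) (sym ∣s∣))))
    where
    drop≡s : drop q w ≡ s
    drop≡s = trans (cong (λ q′ → drop q′ w) (sym ∣v∣)) (drop-length-++ (take q x) s)

module _ {k} (u : Word k) {i} (i≤u : i ≤ length u) where

  private
    ∣x∣ : length (take i u) ≡ i
    ∣x∣ = length-take-≤ i≤u

    letters : ∀ p → p < i → letter (take i u) p ≡ letter u p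
    letters p p<i = letter-prefix (take-prefix i u) p (<-≤-trans p<i (≤-reflexive (sym ∣x∣)))

  unbordered⇒lseedmax : LongestBorder (letter u) i 0 → LSeedMax (take i u) 0
  unbordered⇒lseedmax (_ , max) = inj₂ (noSeed , refl)
    where
    noSeed : ¬ (Σ[ s ∈ Word k ] ShorterLeftSeed s (take i u))
    noSeed (s , S) with b , B ← seed⇒border S =
      contradiction
        (max (suc b) (border-cong letters (subst (λ i′ → Border (letter (take i u)) i′ (suc b)) ∣x∣ B))) λ ()

  -- Dropping the last letter gives a left seed, and no shorter left seed can have more than `i ∸ 1`
  -- letters.
  bordered⇒lseedmax : ∀ {b} → Border (letter u) i (suc b) → LSeedMax (take i u) (i ∸ 1)
  bordered⇒lseedmax {b} B = go i ∣x∣ (border-cong (λ p p<i → sym (letters p p<i)) B)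
    where
    go : ∀ i′ → length (take i u) ≡ i′ → Border (letter (take i u)) i′ (suc b) →
         LSeedMax (take i u) (i′ ∸ 1)
    go zero    _  B = contradiction (border-< B) λ ()
    go (suc n) eq B = inj₁
      ( take n (take i u) , border⇒seed eq B
      , length-take-≤ (≤-trans (n≤1+n n) (≤-reflexive (sym eq)))
      , λ s′ (_ , s′<x) → s≤s⁻¹ (≤-trans s′<x (≤-reflexive eq)) )

-- Programs

update-same : ∀ f i v → update f i v i ≡ v
update-same f i v with i ≟ i
... | yes _   = refl
... | no  i≢i = contradiction refl i≢i

update-other : ∀ f {i} v {j} → i ≢ j → update f i v j ≡ f j
update-other f {i} v {j} i≢j with i ≟ j
... | yes i≡j = contradiction i≡j i≢j
... | no  _   = refl

wrap-small : ∀ {w x} → x < 2 ^ w → wrap w x ≡ x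
wrap-small {w} = m<n⇒m%n≡m {{m^n≢0 2 w}}

module Execution (w : ℕ) (P : Program) (Post : (ℕ → ℕ) → Set) where

  -- `T` is only an upper bound, so branches of different cost can be brought to a common budget by
  -- `weaken`.
  Terminates : State → ℕ → Set
  Terminates σ T = ∃[ t ] ∃[ σ′ ] (Run w P σ t σ′ × t ≤ T × Post (mem σ′))

  weaken : ∀ {σ T T′} → T ≤ T′ → Terminates σ T → Terminates σ T′
  weaken T≤T′ (t , σ′ , run , t≤T , post) = t , σ′ , run , ≤-trans t≤T T≤T′ , post

  run-halt : ∀ {σ T} → fetch P (pc σ) ≡ nothing → Post (mem σ) → Terminates σ T
  run-halt {σ} eq post = 0 , σ , halt eq , z≤n , post

  run-step : ∀ {σ T I} → fetch P (pc σ) ≡ just I →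
             Terminates (exec w I σ) T → Terminates σ (suc T)
  run-step eq (t , σ′ , run , t≤T , post) = suc t , σ′ , step eq run , s≤s t≤T , post

  module _ {p : ℕ} {ρ μ : ℕ → ℕ} {T : ℕ} where

    -- The rules from here on work backwards, from the state after an instruction to the state
    -- before it. The equations on registers and memory let a proof put known values in place of
    -- lookups; the size bounds make `wrap` the identity.
    run-const : ∀ {r c} → fetch P p ≡ just (const r c) → c < 2 ^ w →
                Terminates (state (suc p) (update ρ r c) μ) T →
                Terminates (state p ρ μ) (suc T)
    run-const {r} eq c<2^w rest = run-step eq
      (subst (λ v → Terminates (state (suc p) (update ρ r v) μ) T) (sym (wrap-small {w} c<2^w)) rest)

    run-add : ∀ {r s t a b} → fetch P p ≡ just (add r s t) →
              ρ s ≡ a → ρ t ≡ b → a + b < 2 ^ w →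
              Terminates (state (suc p) (update ρ r (a + b)) μ) T →
              Terminates (state p ρ μ) (suc T)
    run-add {r} eq refl refl small rest = run-step eq
      (subst (λ v → Terminates (state (suc p) (update ρ r v) μ) T) (sym (wrap-small {w} small)) rest)

    run-sub : ∀ {r s t a b} → fetch P p ≡ just (sub r s t) →
              ρ s ≡ a → ρ t ≡ b →
              Terminates (state (suc p) (update ρ r (a ∸ b)) μ) T →
              Terminates (state p ρ μ) (suc T)
    run-sub eq refl refl = run-step eq

    run-load : ∀ {r s a v} → fetch P p ≡ just (load r s) →
               ρ s ≡ a → μ a ≡ v →
               Terminates (state (suc p) (update ρ r v) μ) T →
               Terminates (state p ρ μ) (suc T)
    run-load eq refl refl = run-step eq

    run-store : ∀ {r s a v} → fetch P p ≡ just (store r s) →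
                ρ r ≡ a → ρ s ≡ v →
                Terminates (state (suc p) ρ (update μ a v)) T →
                Terminates (state p ρ μ) (suc T)
    run-store eq refl refl = run-step eq

    run-jump : ∀ {l} → fetch P p ≡ just (jump l) →
               Terminates (state l ρ μ) T → Terminates (state p ρ μ) (suc T)
    run-jump = run-step

    run-jlt-yes : ∀ {r s l a b} → fetch P p ≡ just (jlt r s l) →
                  ρ r ≡ a → ρ s ≡ b → a < b →
                  Terminates (state l ρ μ) T → Terminates (state p ρ μ) (suc T)
    run-jlt-yes {r} {s} {l} eq refl refl a<b rest = run-step eq
      (subst (λ q → Terminates (state q ρ μ) T) (sym taken) rest)
      where
      taken : branch (ρ r <? ρ s) l (suc p) ≡ l
      taken with ρ r <? ρ s
      ... | yes _   = refl
      ... | no  a≮b = contradiction a<b a≮b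

    run-jlt-no : ∀ {r s l a b} → fetch P p ≡ just (jlt r s l) →
                 ρ r ≡ a → ρ s ≡ b → ¬ (a < b) →
                 Terminates (state (suc p) ρ μ) T → Terminates (state p ρ μ) (suc T)
    run-jlt-no {r} {s} {l} eq refl refl a≮b rest = run-step eq
      (subst (λ q → Terminates (state q ρ μ) T) (sym passed) rest)
      where
      passed : branch (ρ r <? ρ s) l (suc p) ≡ suc p
      passed with ρ r <? ρ s
      ... | yes a<b = contradiction a<b a≮b
      ... | no  _   = refl

    run-jeq-yes : ∀ {r s l a b} → fetch P p ≡ just (jeq r s l) →
                  ρ r ≡ a → ρ s ≡ b → a ≡ b →
                  Terminates (state l ρ μ) T → Terminates (state p ρ μ) (suc T)
    run-jeq-yes {r} {s} {l} eq refl refl a≡b rest = run-step eq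
      (subst (λ q → Terminates (state q ρ μ) T) (sym taken) rest)
      where
      taken : branch (ρ r ≟ ρ s) l (suc p) ≡ l
      taken with ρ r ≟ ρ s
      ... | yes _   = refl
      ... | no  a≢b = contradiction a≡b a≢b

    run-jeq-no : ∀ {r s l a b} → fetch P p ≡ just (jeq r s l) →
                 ρ r ≡ a → ρ s ≡ b → a ≢ b →
                 Terminates (state (suc p) ρ μ) T → Terminates (state p ρ μ) (suc T)
    run-jeq-no {r} {s} {l} eq refl refl a≢b rest = run-step eq
      (subst (λ q → Terminates (state q ρ μ) T) (sym passed) rest)
      where
      passed : branch (ρ r ≟ ρ s) l (suc p) ≡ suc p
      passed with ρ r ≟ ρ s
      ... | yes a≡b = contradiction a≡b a≢b
      ... | no  _   = refl

-- Registers and code of the program.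

pattern null = 0
pattern one  = 1
pattern len  = 2
pattern pos  = 3
pattern cand = 4
pattern tmp₁ = 5
pattern tmp₂ = 6
pattern tmp₃ = 7

-- The loop at 3 stores the length of the longest border of the prefix of length m
-- in cell len + m; pos prefixes are done, and cand is the current candidate.  The
-- letters are read until this loop ends, so only the loop at 20 overwrites them.
lseedProgram : Program
lseedProgram =
    load len null          --  0
  ∷ const one 1
  ∷ const pos 1
  ∷ jlt pos len 6          --  3
  -- Subtracting the register that stays 0 copies a register.
  ∷ sub pos len null
  ∷ jump 20
  ∷ add tmp₁ cand one      --  6
  ∷ add tmp₂ pos one
  ∷ load tmp₁ tmp₁
  ∷ load tmp₃ tmp₂
  ∷ jeq tmp₁ tmp₃ 15
  ∷ jeq cand null 16
  ∷ add tmp₁ len cand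
  ∷ load cand tmp₁
  ∷ jump 3
  ∷ add cand cand one      -- 15
  ∷ add tmp₁ len tmp₂      -- 16
  ∷ store tmp₁ cand
  ∷ sub pos tmp₂ null
  ∷ jump 3
  ∷ jeq pos null 29        -- 20
  ∷ add tmp₁ len pos
  ∷ load tmp₂ tmp₁
  ∷ sub tmp₃ pos one
  -- A border length of 0 is itself the right output; any other is replaced by `pos` minus 1.
  ∷ jeq tmp₂ null 26
  ∷ sub tmp₂ tmp₃ null
  ∷ store pos tmp₂         -- 26
  ∷ sub pos tmp₃ null
  ∷ jump 20                -- 28
  ∷ []

-- Correctness and running time of the program.

module _ {k} (u : Word k) {w} (room : 31 * suc (length u) ≤ 2 ^ w) where

  private
    n : ℕ
    n = length u

    -- All sums formed by the program are at most `2n`, the last cell of the table, so no addition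
    -- wraps around.
    fits : ∀ {v} → v ≤ n + n → v < 2 ^ w
    fits {v} v≤2n = begin
      suc v              ≤⟨ s≤s v≤2n ⟩
      suc n + n          ≤⟨ +-monoʳ-≤ (suc n) (≤-trans (n≤1+n n) (m≤m+n (suc n) (29 * suc n))) ⟩
      31 * suc n         ≤⟨ room ⟩
      2 ^ w              ∎
      where open ≤-Reasoning

    1<2^w : 1 < 2 ^ w
    1<2^w = ≤-trans (m≤m+n 2 29) (≤-trans (m≤m*n 31 (suc n)) room)

    open Execution w lseedProgram (LSeedArray u)

    record Constants (ρ : ℕ → ℕ) : Set where
      constructor constants
      field
        null≡0 : ρ null ≡ 0
        one≡1  : ρ one ≡ 1
        len≡n  : ρ len ≡ n
    open Constants

    Letters : (ℕ → ℕ) → Set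
    Letters μ = ∀ p → p < n → μ (suc p) ≡ letter u p

    Table : (ℕ → ℕ) → ℕ → Set
    Table μ i = ∀ m → 0 < m → m ≤ i → LongestBorder (letter u) m (μ (n + m))

    Done : (ℕ → ℕ) → ℕ → Set
    Done μ i = ∀ m → i < m → m ≤ n → LSeedMax (take m u) (μ m)

    table-output : ∀ {μ i v} → i ≤ n → Table μ n → Table (update μ i v) n
    table-output {μ} {i} {v} i≤n table m 0<m m≤n =
      subst (LongestBorder (letter u) m) (sym (update-other μ v (<⇒≢ i<n+m))) (table m 0<m m≤n)
      where
      i<n+m : i < n + m
      i<n+m = ≤-<-trans i≤n (m<m+n n 0<m)

    done-extend : ∀ {μ i v} → LSeedMax (take (suc i) u) v → Done μ (suc i) →
                  Done (update μ (suc i) v) i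
    done-extend {μ} {i} {v} lsm done m i<m m≤n with suc i ≟ m
    ... | yes refl  = lsm
    ... | no  1+i≢m = done m (≤∧≢⇒< i<m 1+i≢m) m≤n

    -- A round takes at most nine instructions, and the final test is one more. Outputs go to cells
    -- up to `n`, below the table, so the entries still to be read survive; the cells above `i` are
    -- final.
    output-loop : ∀ i {ρ μ} → Constants ρ → ρ pos ≡ i → i ≤ n → Table μ n → Done μ i →
                  Terminates (state 20 ρ μ) (i * 9 + 1)
    output-loop zero C pos≡ _ _ done =
      run-jeq-yes refl pos≡ (null≡0 C) refl (run-halt refl done)
    output-loop (suc i) {ρ} {μ} C pos≡ i<n table done =
      run-jeq-no refl pos≡ (null≡0 C) (λ ()) (
      run-add refl (len≡n C) pos≡ (fits (+-monoʳ-≤ n i<n)) (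
      run-load refl refl refl (
      run-sub refl pos≡ (one≡1 C) (
      write (μ (n + suc i)) (table (suc i) (s≤s z≤n) i<n)))))
      where
      -- The table entry is generalised to `b` to allow the case split. The case 0 skips one
      -- instruction, which `weaken` makes up for.
      write : ∀ b → LongestBorder (letter u) (suc i) b →
              Terminates (state 24 (update (update (update ρ tmp₁ (n + suc i)) tmp₂ b) tmp₃ i) μ)
                         (5 + (i * 9 + 1))
      write zero B = weaken (n≤1+n _) (
        run-jeq-yes refl refl (null≡0 C) refl (
        run-store refl pos≡ refl (
        run-sub refl refl (null≡0 C) (
        run-jump refl (
        output-loop i (constants (null≡0 C) (one≡1 C) (len≡n C)) refl (<⇒≤ i<n)
          (table-output i<n table) (done-extend (unbordered⇒lseedmax u i<n B) done))))))
      write (suc b) (B , _) =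
        run-jeq-no refl refl (null≡0 C) (λ ()) (
        run-sub refl refl (null≡0 C) (
        run-store refl pos≡ refl (
        run-sub refl refl (null≡0 C) (
        run-jump refl (
        output-loop i (constants (null≡0 C) (one≡1 C) (len≡n C)) refl (<⇒≤ i<n)
          (table-output i<n table) (done-extend (bordered⇒lseedmax u i<n B) done))))))

    letters-store : ∀ {μ i v} → Letters μ → Letters (update μ (n + suc i) v)
    letters-store {μ} {i} {v} letters p p<n =
      trans (update-other μ v (>⇒≢ 1+p<n+1+i)) (letters p p<n)
      where
      1+p<n+1+i : suc p < n + suc i
      1+p<n+1+i = ≤-<-trans p<n (m<m+n n (s≤s z≤n))

    table-extend : ∀ {μ i v} → LongestBorder (letter u) (suc i) v → Table μ i →
                   Table (update μ (n + suc i) v) (suc i)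
    table-extend {μ} {i} {v} B table m 0<m m≤1+i with m ≟ suc i
    ... | yes refl  = subst (LongestBorder (letter u) m) (sym (update-same μ (n + m) v)) B
    ... | no  m≢1+i = subst (LongestBorder (letter u) m)
      (sym (update-other μ v (λ eq → m≢1+i (sym (+-cancelˡ-≡ n (suc i) m eq)))))
      (table m 0<m (s≤s⁻¹ (≤∧≢⇒< m≤1+i m≢1+i)))

    -- This is the amortisation: advancing `i` lowers the first term by 2 while `j` grows by at most
    -- 1, and falling back lowers `j`. Every round thus costs at least one unit.
    potential : ℕ → ℕ → ℕ
    potential i j = 2 * (n ∸ i) + j

    potential-advance : ∀ {i} → i < n → ∀ j → suc (potential (suc i) (suc j)) ≡ potential i j
    potential-advance {i} i<n j = begin
      suc (2 * d + suc j)  ≡⟨ cong suc (+-suc (2 * d) j) ⟩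
      2 + 2 * d + j        ≡⟨ cong (_+ j) (sym (*-suc 2 d)) ⟩
      2 * suc d + j        ≡⟨ cong (λ e → 2 * e + j) (sym (+-∸-assoc 1 i<n)) ⟩
      potential i j        ∎
      where
      open ≡-Reasoning
      d = n ∸ suc i

    -- Induction on the bound `f` of the potential. A round takes at most eleven instructions;
    -- leaving the loop takes three, followed by the output loop.
    border-loop : ∀ f {i j ρ μ} → Constants ρ → ρ pos ≡ i → ρ cand ≡ j →
                  Letters μ → Table μ i → Candidate {letter u} i j → potential i j ≤ f →
                  Terminates (state 3 ρ μ) (f * 11 + (3 + (n * 9 + 1)))
    border-loop f {i} {j} {ρ} {μ} C pos≡ cand≡ letters table K pot≤f with i <? n
    ... | no i≮n = weaken (m≤n+m _ (f * 11)) (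
      run-jlt-no refl pos≡ (len≡n C) i≮n (
      run-sub refl (len≡n C) (null≡0 C) (
      run-jump refl (
      output-loop n (constants (null≡0 C) (one≡1 C) (len≡n C)) refl ≤-refl
        (λ m 0<m m≤n → table m 0<m (≤-trans m≤n (≮⇒≥ i≮n)))
        (λ m n<m m≤n → contradiction n<m (≤⇒≯ m≤n))))))
    border-loop zero {i} {j} C pos≡ cand≡ letters table K pot≤f | yes i<n =
      contradiction (≤-trans (≤-reflexive (potential-advance i<n j)) pot≤f) λ ()
    border-loop (suc f) {i} {j} {ρ} {μ} C pos≡ cand≡ letters table K pot≤f | yes i<n =
      run-jlt-yes refl pos≡ (len≡n C) i<n (
      run-add refl cand≡ (one≡1 C) (fits j+1≤2n) (
      run-add refl pos≡ (one≡1 C) (fits i+1≤2n) (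
      run-load refl refl (trans (cong μ (+-comm j 1)) (letters j (<-trans j<i i<n))) (
      run-load refl refl (trans (cong μ (+-comm i 1)) (letters i i<n))
      compare))))
      where
      j<i : j < i
      j<i = border-< (proj₁ K)

      i+1≤2n : i + 1 ≤ n + n
      i+1≤2n = ≤-trans (≤-reflexive (+-comm i 1)) (≤-trans i<n (m≤m+n n n))

      j+1≤2n : j + 1 ≤ n + n
      j+1≤2n = ≤-trans (+-monoˡ-≤ 1 (<⇒≤ j<i)) i+1≤2n

      ρ′ : ℕ → ℕ
      ρ′ = update (update (update (update ρ tmp₁ (j + 1)) tmp₂ (i + 1))
                          tmp₁ (letter u j)) tmp₃ (letter u i)

      rest : ℕ
      rest = f * 11 + (3 + (n * 9 + 1))

      advance≤ : potential (suc i) (suc j) ≤ f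
      advance≤ = s≤s⁻¹ (≤-trans (≤-reflexive (potential-advance i<n j)) pot≤f)

      -- The common tail of a match, where `j′` is `suc j`, and of a mismatch at candidate 0, where
      -- `j′` is 0.
      record-border : ∀ {ρ j′} → Constants ρ → ρ cand ≡ j′ → ρ tmp₂ ≡ i + 1 →
                      LongestBorder (letter u) (suc i) j′ → j′ ≤ suc j →
                      Terminates (state 16 ρ μ) (4 + rest)
      record-border {j′ = j′} C′ cand≡′ tmp₂≡ B j′≤1+j =
        run-add refl (len≡n C′) tmp₂≡′ (fits (+-monoʳ-≤ n i<n)) (
        run-store refl refl cand≡′ (
        run-sub refl tmp₂≡′ (null≡0 C′) (
        run-jump refl (
        border-loop f (constants (null≡0 C′) (one≡1 C′) (len≡n C′)) refl cand≡′
          (letters-store letters) (table-extend B table) (longest⇒candidate B)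
          (≤-trans (+-monoʳ-≤ (2 * (n ∸ suc i)) j′≤1+j) advance≤)))))
        where
        tmp₂≡′ = trans tmp₂≡ (+-comm i 1)

      mismatch : letter u j ≢ letter u i → Terminates (state 11 ρ′ μ) (5 + rest)
      mismatch neq with j ≟ 0
      ... | yes refl = run-jeq-yes refl cand≡ (null≡0 C) refl (
        record-border (constants (null≡0 C) (one≡1 C) (len≡n C)) cand≡ refl
          (mismatch⇒longest K neq) z≤n)
      -- The fallback reads the table at `j < i`, an entry already filled. It keeps `i` and strictly
      -- lowers the candidate; it is one instruction cheaper than the other branches.
      ... | no  j≢0  = weaken (n≤1+n _) (
        run-jeq-no refl cand≡ (null≡0 C) j≢0 (
        run-add refl (len≡n C) cand≡ (fits (+-monoʳ-≤ n (<⇒≤ (<-trans j<i i<n)))) (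
        run-load refl refl refl (
        run-jump refl (
        border-loop f (constants (null≡0 C) (one≡1 C) (len≡n C)) pos≡ refl
          letters table (mismatch⇒candidate K neq B)
          (s≤s⁻¹ (<-≤-trans (+-monoʳ-< (2 * (n ∸ i)) (border-< (proj₁ B))) pot≤f)))))))
        where
        B : LongestBorder (letter u) j (μ (n + j))
        B = table j (n≢0⇒n>0 j≢0) (<⇒≤ j<i)

      compare : Terminates (state 10 ρ′ μ) (6 + rest)
      compare with letter u j ≟ letter u i
      ... | yes eq = run-jeq-yes refl refl refl eq (
        run-add refl cand≡ (one≡1 C) (fits j+1≤2n) (
        record-border (constants (null≡0 C) (one≡1 C) (len≡n C)) (+-comm j 1) refl
          (match⇒longest K eq) ≤-refl))
      ... | no neq = run-jeq-no refl refl refl neq (mismatch neq)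

    contents-end : ∀ (v : Word k) → contents (map toℕ v) (length v) ≡ 0
    contents-end []      = refl
    contents-end (_ ∷ v) = contents-end v

    -- Cell `n + 1` lies just past the input and holds the default 0, which is the right entry for
    -- the prefix of length 1. So the loop can start at `pos` equal to 1 with nothing stored.
    initial-table : Table (mem (initial u)) 1
    initial-table m 0<m m≤1 with refl ← ≤-antisym m≤1 0<m =
      subst (LongestBorder (letter u) 1)
        (sym (trans (cong (mem (initial u)) (+-comm n 1)) (contents-end u))) longest-initial

    -- Three instructions of setup, at most `2n` rounds of eleven, three to leave the loop and
    -- `9n + 1` for the output make at most `31n + 7`. This is 24 below the bound, and it is where
    -- the constant 31 comes from.
    time-bound : 3 + (potential 1 0 * 11 + (3 + (n * 9 + 1))) ≤ 31 * suc n
    time-bound = begin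
      3 + (potential 1 0 * 11 + (3 + (n * 9 + 1)))
        ≤⟨ +-monoʳ-≤ 3 (+-monoˡ-≤ _ (*-monoˡ-≤ 11 (+-monoˡ-≤ 0 (*-monoʳ-≤ 2 (m∸n≤m n 1))))) ⟩
      3 + ((2 * n + 0) * 11 + (3 + (n * 9 + 1)))
        ≤⟨ m≤m+n _ 24 ⟩
      3 + ((2 * n + 0) * 11 + (3 + (n * 9 + 1))) + 24
        ≡⟨ total n ⟩
      31 * suc n ∎
      where
      open ≤-Reasoning
      total : ∀ n → 3 + ((2 * n + 0) * 11 + (3 + (n * 9 + 1))) + 24 ≡ 31 * suc n
      total = solve-∀

  lseedProgram-correct : ∃[ t ] ∃[ σ ] (Run w lseedProgram (initial u) t σ
                           × t ≤ 31 * suc (length u) × LSeedArray u (mem σ))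
  lseedProgram-correct = weaken time-bound (
    run-load refl refl refl (
    run-const refl 1<2^w (
    run-const refl 1<2^w (
    border-loop (potential 1 0) (constants refl refl refl) refl refl
      (λ _ _ → refl) initial-table candidate-initial ≤-refl))))

theorem3 : (k : ℕ) → ComputableInLinearTime k LSeedArray
theorem3 k = lseedProgram , 31 , λ u w _ room → lseedProgram-correct u room
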